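{- Let $n>1$, $\textsf{AP}=\{p\}$, and let $K_n$ and $M_n$ be tree structures as described in the context. Then for every HyperCTL$^*$ sentence $\psi$ over $\{p\}$ with $|\psi|<n$, $K_n\models\psi$ if and only if $M_n\models\psi$.
   Context: HyperCTL$^*$: $\varphi::=\top\mid p[x]\mid\neg\varphi\mid\varphi\wedge\varphi\mid\textsf{X}\varphi\mid\varphi\textsf{U}\varphi\mid\exists x.\varphi$ with path variables $x$; evaluated on a Kripke structure (total transition relation, valuation $V$) at a path assignment $\Pi$ (variables to initial paths), current variable $y$, position $i$: $p[x]$ holds iff $p\in V(\Pi(x)(i))$; $\exists x.\varphi$ holds iff some initial path $\pi$ with $\pi[0,i]=\Pi(y)[0,i]$ gives $\Pi[x\leftarrow\pi],x,i\models\varphi$; Booleans, $\textsf{X}$, $\textsf{U}$ standard. A sentence has all temporal modalities under a quantifier and all variables bound; $K\models\varphi$ iff $\Pi,y,0\models\varphi$ for some $\Pi,y$. $|\psi|$ is the size of $\psi$. Tree structures: nodes form a prefix-closed subset of $\mathbb{N}^*$, root $\varepsilon$ initial, edges only to children; regular = unwinding of a finite Kripke structure. Words over $2^{\{p\}}$: an $n$-block is a word in $\{p\}\emptyset^*$ of length at least $n+2$. For words $w_1,\ldots,w_k$ of common length $\ell$, $\textit{join}(w_1,\ldots,w_k)$ is the word of length $\ell$ with $i$-th letter $w_1(i)\cup\cdots\cup w_k(i)$. The dual $\widetilde w$ of $w$ has the same length and $p\in\widetilde w(i)$ iff $p\notin w(i)$. A tuple $\langle w_1,\ldots,w_n\rangle$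 of words of the same length satisfies the $n$-fractal requirement if for all $k\in[1,n]$, $\textit{join}(w_1,\ldots,w_k)=bl^k_1\cdots bl^k_{m_k}\cdot\{p\}$ with $bl^k_1,\ldots,bl^k_{m_k}$ $n$-blocks, $m_1=n+4$, and for $k<n$, $w_{k+1}$ is obtained from $\textit{join}(w_1,\ldots,w_k)$ by replacing its last symbol with $\emptyset$ and replacing each $n$-block $bl^k_i$ by a sequence of $n+4$ $n$-blocks preceded by a non-empty word in $\emptyset^*$ of length at least $n+2$. $K_n$ is any regular tree structure over $2^{\{p\}}$ such that for some $\ell_n>1$: the root has exactly $n+1$ distinct successors $\eta,\xi_1,\ldots,\xi_n$, with a unique initial path through $\eta$ (denoted $\pi(\eta)$) and through each $\xi_k$ (denoted $\pi(\xi_k)$); there are words $w_0,\ldots,w_n$ of length $\ell_n$ such that the trace of $\pi(\eta)$ is $\emptyset\,w_0\,\{p\}^\omega$, the trace of $\pi(\xi_k)$ is $\emptyset\,w_k\,\emptyset^\omega$ for $k\in[1,n]$, $\langle w_1,\ldots,w_n\rangle$ satisfies the $n$-fractal requirement, and $w_0$ is the dual of $\textit{join}(w_1,\ldots,w_n)$. A main position is a position in $[1,\ell_n]$. Let $i_{\textit{alert}}$ be the third (in increasing order) main position $i$ such that the label of $\pi(\xi_1)(i)$ in $K_n$ is $\{p\}$. $M_n$ is obtained from $K_n$ by replacing the label $\{p\}$ of $\pi(\xi_1)$ at position $i_{\textit{alert}}$ with $\emptyset$.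
   Formalization: In the n-fractal requirement, each n-block is taken to be replaced by a word of the same length as that block, so the words stay aligned; with only the common total length required, misaligned tuples would make the claim fail for large n. -}

module Defs where

open import Data.Nat using (ℕ; zero; suc; _+_; _≤_; _<_; _<?_; _≡ᵇ_; _≟_)
open import Data.Fin using (Fin; toℕ; fromℕ<)
open import Data.Fin.Properties using (fromℕ<-toℕ; toℕ<n)
open import Data.Bool using (Bool; true; false; not; _∨_; if_then_else_; T)
open import Data.List using (List; []; _∷_; _++_; length; map; concat; replicate; zipWith)
open import Data.List.Relation.Unary.All using (All)
open import Data.List.Membership.Propositional using (_∈_)
open import Data.List.Relation.Binary.Pointwise using (Pointwise)
open import Data.List.Properties using (≡-dec)
open import Data.Maybe using (Maybe; just; nothing; maybe; is-just; _>>=_)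
open import Data.Product using (Σ; _×_; _,_; proj₁; proj₂)
open import Data.Sum using (_⊎_)
open import Data.Unit using (⊤; tt)
open import Data.Empty using (⊥-elim)
open import Relation.Nullary using (¬_; yes; no; does)
open import Relation.Binary.PropositionalEquality

-- Kripke structures over AP = {p}  (V s = true  iff  p ∈ V(s))

record Kripke : Set₁ where
  field
    S     : Set
    Init  : S → Set
    R     : S → S → Set
    total : ∀ s → Σ S (R s)
    V     : S → Bool

module _ (K : Kripke) where
  open Kripke K

  record InitPath : Set where
    field
      seq  : ℕ → S
      step : ∀ i → R (seq i) (seq (suc i))
      start : Init (seq 0)

open InitPath public

Var : Set
Var = ℕ

data Formula : Set where
  ⊤ᶠ    : Formula
  p[_]  : Var → Formula
  ¬ᶠ_   : Formula → Formula
  _∧ᶠ_  : Formula → Formula → Formula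
  Xᶠ_   : Formula → Formula
  _Uᶠ_  : Formula → Formula → Formula
  ∃ᶠ_∙_ : Var → Formula → Formula

size : Formula → ℕ
size ⊤ᶠ = 1
size p[ x ] = 1
size (¬ᶠ φ) = suc (size φ)
size (φ ∧ᶠ ψ) = suc (size φ + size ψ)
size (Xᶠ φ) = suc (size φ)
size (φ Uᶠ ψ) = suc (size φ + size ψ)
size (∃ᶠ x ∙ φ) = suc (size φ)

Closed : List Var → Formula → Set
Closed Γ ⊤ᶠ = ⊤
Closed Γ p[ x ] = x ∈ Γ
Closed Γ (¬ᶠ φ) = Closed Γ φ
Closed Γ (φ ∧ᶠ ψ) = Closed Γ φ × Closed Γ ψ
Closed Γ (Xᶠ φ) = Closed Γ φ
Closed Γ (φ Uᶠ ψ) = Closed Γ φ × Closed Γ ψ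
Closed Γ (∃ᶠ x ∙ φ) = Closed (x ∷ Γ) φ

Guarded : Bool → Formula → Set
Guarded b ⊤ᶠ = ⊤
Guarded b p[ x ] = ⊤
Guarded b (¬ᶠ φ) = Guarded b φ
Guarded b (φ ∧ᶠ ψ) = Guarded b φ × Guarded b ψ
Guarded b (Xᶠ φ) = T b × Guarded b φ
Guarded b (φ Uᶠ ψ) = T b × Guarded b φ × Guarded b ψ
Guarded b (∃ᶠ x ∙ φ) = Guarded true φ

Sentence : Formula → Set
Sentence φ = Closed [] φ × Guarded false φ

Assignment : Kripke → Set
Assignment K = Var → InitPath K

update : {K : Kripke} → Assignment K → Var → InitPath K → Assignment K
update Π x π z = if z ≡ᵇ x then π else Π z

Sat : (K : Kripke) → Formula → Assignment K → Var → ℕ → Set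
Sat K ⊤ᶠ Π y i = ⊤
Sat K p[ x ] Π y i = Kripke.V K (seq (Π x) i) ≡ true
Sat K (¬ᶠ φ) Π y i = ¬ Sat K φ Π y i
Sat K (φ ∧ᶠ ψ) Π y i = Sat K φ Π y i × Sat K ψ Π y i
Sat K (Xᶠ φ) Π y i = Sat K φ Π y (suc i)
Sat K (φ Uᶠ ψ) Π y i =
  Σ ℕ λ k → i ≤ k × Sat K ψ Π y k × (∀ j → i ≤ j → j < k → Sat K φ Π y j)
Sat K (∃ᶠ x ∙ φ) Π y i =
  Σ (InitPath K) λ π → (∀ j → j ≤ i → seq π j ≡ seq (Π y) j)
                     × Sat K φ (update Π x π) x i

Models : Kripke → Formula → Set
Models K φ = Σ (Assignment K) λ Π → Σ Var λ y → Sat K φ Π y 0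

-- Finite Kripke structures (single initial state) and their unwindings
-- (regular tree structures; nodes are words in ℕ*, child of u is u ++ [c])

record FinKripke : Set where
  field
    m     : ℕ
    init  : Fin m
    E     : Fin m → Fin m → Bool
    total : ∀ s → Σ (Fin m) λ t → E s t ≡ true
    lab   : Fin m → Bool

module Unwinding (F : FinKripke) where
  open FinKripke F

  stepF : Fin m → ℕ → Maybe (Fin m)
  stepF s c with c <? m
  ... | yes p = if E s (fromℕ< p) then just (fromℕ< p) else nothing
  ... | no _  = nothing

  walk : Fin m → List ℕ → Maybe (Fin m)
  walk s [] = just s
  walk s (c ∷ w) = stepF s c >>= λ t → walk t w

  Node : List ℕ → Set
  Node w = T (is-just (walk init w))

  walk-++ : ∀ s u v → walk s (u ++ v) ≡ (walk s u >>= λ t → walk t v)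
  walk-++ s [] v = refl
  walk-++ s (c ∷ u) v with stepF s c
  ... | nothing = refl
  ... | just t  = walk-++ t u v

  stepF-toℕ : ∀ s t → E s t ≡ true → stepF s (toℕ t) ≡ just t
  stepF-toℕ s t e with toℕ t <? m
  ... | yes p rewrite fromℕ<-toℕ t p | e = refl
  ... | no ¬p = ⊥-elim (¬p (toℕ<n t))

  child : (w : List ℕ) → Node w → Σ ℕ λ c → Node (w ++ c ∷ [])
  child w nw with walk init w in eq
  ... | just s = toℕ t , subst (λ x → T (is-just x)) (sym lem) tt
    where
      t = proj₁ (total s)
      lem : walk init (w ++ toℕ t ∷ []) ≡ just t
      lem rewrite walk-++ init w (toℕ t ∷ []) | eq
                | stepF-toℕ s t (proj₂ (total s)) = refl

  unwind : Kripke
  unwind = record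
    { S     = Σ (List ℕ) Node
    ; Init  = λ s → proj₁ s ≡ []
    ; R     = λ s t → Σ ℕ λ c → proj₁ t ≡ proj₁ s ++ c ∷ []
    ; total = λ s → let (c , nc) = child (proj₁ s) (proj₂ s)
                    in (proj₁ s ++ c ∷ [] , nc) , c , refl
    ; V     = λ s → maybe lab false (walk init (proj₁ s))
    }

  root : Kripke.S unwind
  root = [] , tt

  relabel : List ℕ → Kripke
  relabel v = record unwind
    { V = λ s → if does (≡-dec _≟_ (proj₁ s) v) then false
                else Kripke.V unwind s }

-- Words over 2^{p} (true = {p}, false = ∅)

Word : Set
Word = List Bool

nthOr : Bool → Word → ℕ → Bool
nthOr b [] i = b
nthOr b (x ∷ w) zero = x
nthOr b (x ∷ w) (suc i) = nthOr b w i

lasso : Word → Bool → ℕ → Bool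
lasso w b zero = false
lasso w b (suc j) = nthOr b w j

join₂ : Word → Word → Word
join₂ = zipWith _∨_

-- join(w 1, …, w k)  (for k ≥ 1)
joinUpTo : (ℕ → Word) → ℕ → Word
joinUpTo w zero = []
joinUpTo w (suc zero) = w 1
joinUpTo w (suc (suc k)) = join₂ (joinUpTo w (suc k)) (w (suc (suc k)))

dual : Word → Word
dual = map not

IsBlock : ℕ → Word → Set
IsBlock n bl = Σ ℕ λ j → n + 2 ≤ suc j × bl ≡ true ∷ replicate j false

Replacement : ℕ → Word → Word → Set
Replacement n bl r =
  length r ≡ length bl ×
  (Σ ℕ λ z → Σ (List Word) λ bs →
     n + 2 ≤ z × All (IsBlock n) bs × length bs ≡ n + 4 ×
     r ≡ replicate z false ++ concat bs)

FractalReq : ℕ → (ℕ → Word) → Set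
FractalReq n w =
  ∀ k → 1 ≤ k → k ≤ n →
  Σ (List Word) λ bls →
    All (IsBlock n) bls ×
    joinUpTo w k ≡ concat bls ++ true ∷ [] ×
    (k ≡ 1 → length bls ≡ n + 4) ×
    (k < n → Σ (List Word) λ rs →
               Pointwise (Replacement n) bls rs ×
               w (suc k) ≡ concat rs ++ false ∷ [])

record KnSpec (n : ℕ) (F : FinKripke) : Set where
  open Unwinding F
  open Kripke unwind
  field
    ℓ      : ℕ
    1<ℓ    : 1 < ℓ
    η      : S
    ξ      : ℕ → S
    η-succ : R root η
    ξ-succ : ∀ k → 1 ≤ k → k ≤ n → R root (ξ k)
    η≢ξ    : ∀ k → 1 ≤ k → k ≤ n → ¬ (η ≡ ξ k)
    ξ-inj  : ∀ k k' → 1 ≤ k → k ≤ n → 1 ≤ k' → k' ≤ n → ξ k ≡ ξ k' → k ≡ k'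
    succ-exhaustive : ∀ s → R root s →
                      s ≡ η ⊎ (Σ ℕ λ k → 1 ≤ k × k ≤ n × s ≡ ξ k)
    πη     : InitPath unwind
    πη-η   : seq πη 1 ≡ η
    πη-uniq : ∀ (π : InitPath unwind) → seq π 1 ≡ η → ∀ i → seq π i ≡ seq πη i
    πξ     : ℕ → InitPath unwind
    πξ-ξ   : ∀ k → 1 ≤ k → k ≤ n → seq (πξ k) 1 ≡ ξ k
    πξ-uniq : ∀ k → 1 ≤ k → k ≤ n → ∀ (π : InitPath unwind) →
              seq π 1 ≡ ξ k → ∀ i → seq π i ≡ seq (πξ k) i
    w      : ℕ → Word
    w-len  : ∀ k → k ≤ n → length (w k) ≡ ℓ
    trace-η : ∀ i → V (seq πη i) ≡ lasso (w 0) true i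
    trace-ξ : ∀ k → 1 ≤ k → k ≤ n → ∀ i → V (seq (πξ k) i) ≡ lasso (w k) false i
    fractal : FractalReq n w
    w0-dual : w 0 ≡ dual (joinUpTo w n)

IsAlert : {n : ℕ} {F : FinKripke} → KnSpec n F → ℕ → Set
IsAlert {n} {F} D ia =
  1 ≤ ia × ia ≤ ℓ × L ia ≡ true ×
  (Σ ℕ λ a → Σ ℕ λ b → 1 ≤ a × a < b × b < ia × L a ≡ true × L b ≡ true ×
     (∀ j → 1 ≤ j → j < ia → L j ≡ true → j ≡ a ⊎ j ≡ b))
  where
    open KnSpec D
    L : ℕ → Bool
    L i = Kripke.V (Unwinding.unwind F) (seq (πξ 1) i)

Kn : FinKripke → Kripke
Kn F = Unwinding.unwind F

Mn : {n : ℕ} (F : FinKripke) → KnSpec n F → ℕ → Kripke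
Mn F D ia = Unwinding.relabel F (proj₁ (seq (KnSpec.πξ D 1) ia))

{-# OPTIONS --safe #-}

-- Both structures branch only at the root, so a sentence with |ψ| < n holds at most n − 2
-- of the n + 1 paths at a time, and some ξ_k with 2 ≤ k ≤ n stays hidden.  The supports of
-- w_0, …, w_n partition the main positions, so the joint trace is a word over the symbols
-- 0, …, n.  Written in blocks a 0…0, it spells θ_n ⋯ θ_2 (1^N) 1, where N = n + 4 and θ_j
-- maps a to a j^N.  As long as ξ_k is hidden, M_n only turns the third 1 into a k.  For
-- temporal depth at most n, v^m and v^m′ are interchangeable when m, m′ > n; hence writing
-- θ_n ⋯ θ_2 (a) = a T, the word T k T is interchangeable with T, which reduces the change
-- to replacing (1 T)^N by (1 T)^(N−1).

module Submission where

open import Defs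
open import Data.Bool using (Bool; true; false; T; not; _∨_)
open import Data.Bool.Properties using (∨-identityʳ; not-involutive; T-irrelevant)
open import Data.List using (List; []; _∷_; _++_; length; map; filter; concat; concatMap; replicate)
open import Data.List.Properties
open import Data.List.Membership.Propositional using (_∈_; _∉_)
open import Data.List.Membership.Propositional.Properties using (∈-map⁺; ∈-filter⁺)
open import Data.List.Relation.Binary.Pointwise as Pointwise using (Pointwise; []; _∷_)
open import Data.List.Relation.Unary.All as All using (All; []; _∷_)
import Data.List.Relation.Unary.All.Properties as All
open import Data.List.Relation.Unary.Any as Any using (here; there)
open import Data.Nat using (ℕ; zero; suc; _+_; _∸_; _≤_; _<_; z≤n; s≤s; _<?_; _≡ᵇ_; _≟_)
open import Data.Nat.Properties hiding (_≟_; _<?_)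
open import Data.List.Membership.DecPropositional _≟_ using (_∈?_)
open import Data.Product using (∃; ∃₂; _×_; _,_; proj₁; proj₂)
open import Data.Sum using (_⊎_; inj₁; inj₂)
open import Data.Unit using (tt)
open import Function.Bundles using (_⇔_; mk⇔)
open import Relation.Binary.Definitions using (tri<; tri≈; tri>)
open import Relation.Binary.PropositionalEquality
open import Relation.Nullary using (¬_; ¬?; yes; no; contradiction)

-- Equivalence up to temporal depth

Stream : Set
Stream = ℕ → ℕ

drop : ℕ → Stream → Stream
drop k x i = x (k + i)

infixr 5 _∷ˢ_ _⊕_

_∷ˢ_ : ℕ → Stream → Stream
(a ∷ˢ x) zero = a
(a ∷ˢ x) (suc i) = x i

_⊕_ : List ℕ → Stream → Stream
[] ⊕ x = x
(a ∷ u) ⊕ x = a ∷ˢ u ⊕ x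

++-⊕ : ∀ u v x → (u ++ v) ⊕ x ≡ u ⊕ v ⊕ x
++-⊕ [] v x = refl
++-⊕ (a ∷ u) v x = cong (a ∷ˢ_) (++-⊕ u v x)

drop-⊕ : ∀ u k x → drop (length u + k) (u ⊕ x) ≡ drop k x
drop-⊕ [] k x = refl
drop-⊕ (a ∷ u) k x = drop-⊕ u k x

-- The until move of the game: a witness k in x is answered by k′ in y, and every earlier point of y
-- must then be answered by a point before k in x. This is what carries an until formula from x to
-- y.
Matches : (Stream → Stream → Set) → Stream → Stream → Set
Matches E x y =
  ∀ k → ∃ λ k′ → E (drop k x) (drop k′ y) ×
                 (∀ j′ → j′ < k′ → ∃ λ j → j < k × E (drop j x) (drop j′ y))

infix 4 _≈[_]_

-- The Ehrenfeucht–Fraïssé equivalence for d nested X and U.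
data _≈[_]_ : Stream → ℕ → Stream → Set where
  now : ∀ {x y} → x 0 ≡ y 0 → x ≈[ 0 ] y
  later : ∀ {d x y} → x 0 ≡ y 0 → drop 1 x ≈[ d ] drop 1 y →
         Matches _≈[ d ]_ x y → Matches _≈[ d ]_ y x → x ≈[ suc d ] y

≈-head : ∀ {d x y} → x ≈[ d ] y → x 0 ≡ y 0
≈-head (now e) = e
≈-head (later e _ _ _) = e

≈-ext : ∀ d {x y} → (∀ i → x i ≡ y i) → x ≈[ d ] y
≈-ext zero e = now (e 0)
≈-ext (suc d) e = later (e 0) (≈-ext d (λ i → e (suc i)))
  (λ k → k , ≈-ext d (λ i → e (k + i)) , λ j j<k → j , j<k , ≈-ext d (λ i → e (j + i)))
  (λ k → k , ≈-ext d (λ i → sym (e (k + i))) , λ j j<k → j , j<k , ≈-ext d (λ i → sym (e (j + i))))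

≈-refl : ∀ d {x} → x ≈[ d ] x
≈-refl d = ≈-ext d (λ _ → refl)

≈-reflexive : ∀ d {x y} → x ≡ y → x ≈[ d ] y
≈-reflexive d refl = ≈-refl d

≈-sym : ∀ {d x y} → x ≈[ d ] y → y ≈[ d ] x
≈-sym (now e) = now (sym e)
≈-sym (later e t f b) = later (sym e) (≈-sym t) b f

≈-trans : ∀ {d x y z} → x ≈[ d ] y → y ≈[ d ] z → x ≈[ d ] z
≈-trans-matches : ∀ {d x y z} → Matches _≈[ d ]_ x y → Matches _≈[ d ]_ y z →
                  Matches _≈[ d ]_ x z

≈-trans (now e) (now e′) = now (trans e e′)
≈-trans {x = x} {y} {z} (later e t f b) (later e′ t′ f′ b′) =
  later (trans e e′) (≈-trans t t′)
    (≈-trans-matches {x = x} {y} {z} f f′) (≈-trans-matches {x = z} {y} {x} b′ b)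

≈-trans-matches f g k with f k
... | k′ , p , ps with g k′
... | k″ , q , qs = k″ , ≈-trans p q , λ j″ j″<k″ →
  let (j′ , j′<k′ , r) = qs j″ j″<k″ ; (j , j<k , s) = ps j′ j′<k′
  in j , j<k , ≈-trans s r

≈-pred : ∀ {d x y} → x ≈[ suc d ] y → x ≈[ d ] y
≈-pred {zero} (later e _ _ _) = now e
≈-pred {suc d} {x} {y} (later e t f b) = later e (≈-pred t) (weaken {x} {y} f) (weaken {y} {x} b)
  where
  weaken : ∀ {x y} → Matches _≈[ suc d ]_ x y → Matches _≈[ d ]_ x y
  weaken m k with m k
  ... | k′ , p , ps = k′ , ≈-pred p , λ j′ j′<k′ →
    let (j , j<k , q) = ps j′ j′<k′ in j , j<k , ≈-pred q

-- Prefixing costs no depth: the new position 0 is answered by itself, and later moves are the moves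
-- of x and y shifted by one.
≈-cons : ∀ {d} a {x y} → x ≈[ d ] y → a ∷ˢ x ≈[ d ] a ∷ˢ y
≈-cons {zero} a p = now refl
≈-cons {suc d} a {x} {y} p@(later _ _ f b) = later refl (≈-pred p)
  (shift {x} {y} f (≈-pred p)) (shift {y} {x} b (≈-sym (≈-pred p)))
  where
  shift : ∀ {x y} → Matches _≈[ d ]_ x y → x ≈[ d ] y → Matches _≈[ d ]_ (a ∷ˢ x) (a ∷ˢ y)
  shift m q zero = 0 , ≈-cons a q , λ _ ()
  shift m q (suc k) with m k
  ... | k′ , r , rs = suc k′ , r , λ where
    zero _ → 0 , s≤s z≤n , ≈-cons a q
    (suc j′) (s≤s j′<k′) → let (j , j<k , s) = rs j′ j′<k′ in suc j , s≤s j<k , s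

≈-⊕ : ∀ {d} u {x y} → x ≈[ d ] y → u ⊕ x ≈[ d ] u ⊕ y
≈-⊕ [] p = p
≈-⊕ (a ∷ u) p = ≈-cons a (≈-⊕ u p)

≈-drop-⊕ : ∀ {d} u {x y} → x ≈[ d ] y → ∀ k → k ≤ length u → drop k (u ⊕ x) ≈[ d ] drop k (u ⊕ y)
≈-drop-⊕ u p zero _ = ≈-⊕ u p
≈-drop-⊕ (a ∷ u) p (suc k) (s≤s k≤) = ≈-drop-⊕ u p k k≤

-- Positions inside the first copy of u are compared through the hypothesis on what follows; later
-- positions meet literally the same suffix on the other side, one copy away.
≈-pump : ∀ {d} a v {x} → let u = a ∷ v in
         x ≈[ d ] u ⊕ x → u ⊕ x ≈[ suc d ] u ⊕ u ⊕ x
≈-pump {d} a v {x} p = later refl (≈-⊕ v p) forth back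
  where
  u = a ∷ v
  ℓ = length u

  forth : Matches _≈[ d ]_ (u ⊕ x) (u ⊕ u ⊕ x)
  forth k with k <? ℓ
  ... | yes k<ℓ = k , ≈-drop-⊕ u p k (<⇒≤ k<ℓ) , λ j j<k →
    j , j<k , ≈-drop-⊕ u p j (<⇒≤ (<-trans j<k k<ℓ))
  -- The answer lies one copy later. A point inside the added copy is answered by the same offset,
  -- which precedes k because k ≥ ℓ.
  ... | no k≮ℓ = ℓ + k , ≈-reflexive d (sym (drop-⊕ u k (u ⊕ x))) , earlier
    where
    earlier : ∀ j′ → j′ < ℓ + k → ∃ λ j → j < k × drop j (u ⊕ x) ≈[ d ] drop j′ (u ⊕ u ⊕ x)
    earlier j′ j′< with j′ <? ℓ
    ... | yes j′<ℓ = j′ , <-≤-trans j′<ℓ (≮⇒≥ k≮ℓ) , ≈-drop-⊕ u p j′ (<⇒≤ j′<ℓ)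
    ... | no j′≮ℓ with m≤n⇒∃[o]m+o≡n (≮⇒≥ j′≮ℓ)
    ... | r , refl = r , +-cancelˡ-< ℓ r k j′< , ≈-reflexive d (sym (drop-⊕ u r (u ⊕ x)))

  back : Matches _≈[ d ]_ (u ⊕ u ⊕ x) (u ⊕ x)
  back k with k <? ℓ
  ... | yes k<ℓ = k , ≈-sym (≈-drop-⊕ u p k (<⇒≤ k<ℓ)) , λ j j<k →
    j , j<k , ≈-sym (≈-drop-⊕ u p j (<⇒≤ (<-trans j<k k<ℓ)))
  ... | no k≮ℓ with m≤n⇒∃[o]m+o≡n (≮⇒≥ k≮ℓ)
  ... | r , refl = r , ≈-reflexive d (drop-⊕ u r (u ⊕ x)) , λ j j<r →
    ℓ + j , +-monoʳ-< ℓ j<r , ≈-reflexive d (drop-⊕ u j (u ⊕ x))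

pow : ℕ → List ℕ → List ℕ
pow m v = concat (replicate m v)

pow-+ : ∀ m m′ v → pow (m + m′) v ≡ pow m v ++ pow m′ v
pow-+ zero m′ v = refl
pow-+ (suc m) m′ v = trans (cong (v ++_) (pow-+ m m′ v)) (sym (++-assoc v (pow m v) (pow m′ v)))

pow-snoc : ∀ m v → pow (suc m) v ≡ pow m v ++ v
pow-snoc m v = trans (cong (λ i → pow i v) (+-comm 1 m))
                     (trans (pow-+ m 1 v) (cong (pow m v ++_) (++-identityʳ v)))

-- Induction on d: `≈-pump` spends one copy of v per level of depth, which gives the bound d < m.
≈-pow-suc : ∀ d m v x → d < m → pow m v ⊕ x ≈[ d ] pow (suc m) v ⊕ x
≈-pow-suc d m [] x _ = ≈-refl d
≈-pow-suc zero (suc m) (a ∷ v) x _ = now refl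
≈-pow-suc (suc d) (suc m) u@(a ∷ v) x (s≤s d<m) =
  subst₂ _≈[ suc d ]_ (sym (++-⊕ u (pow m u) x))
    (trans (cong (u ⊕_) (sym (++-⊕ u (pow m u) x))) (sym (++-⊕ u (pow (suc m) u) x)))
    (≈-pump a v (subst (pow m u ⊕ x ≈[ d ]_) (++-⊕ u (pow m u) x) (≈-pow-suc d m u x d<m)))

-- Congruences on words and on block words

module Congruence (n : ℕ) where

  infix 4 _≃_ _≋_

  -- Quantifying over every continuation x makes this a congruence for concatenation.
  record _≃_ (u v : List ℕ) : Set where
    constructor mk≃
    field _▹_ : ∀ x → u ⊕ x ≈[ n ] v ⊕ x
  open _≃_ public

  ≃-refl : ∀ {u} → u ≃ u
  ≃-refl = mk≃ λ x → ≈-refl n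

  ≃-sym : ∀ {u v} → u ≃ v → v ≃ u
  ≃-sym p = mk≃ λ x → ≈-sym (p ▹ x)

  ≃-trans : ∀ {u v t} → u ≃ v → v ≃ t → u ≃ t
  ≃-trans p q = mk≃ λ x → ≈-trans (p ▹ x) (q ▹ x)

  ≃-++ : ∀ {u u′ v v′} → u ≃ u′ → v ≃ v′ → u ++ v ≃ u′ ++ v′
  ≃-++ {u} {u′} {v} {v′} p q = mk≃ λ x →
    subst₂ _≈[ n ]_ (sym (++-⊕ u v x)) (sym (++-⊕ u′ v′ x))
      (≈-trans (≈-⊕ u (q ▹ x)) (p ▹ (v′ ⊕ x)))

  ≃-pow : ∀ {m m′} v → n < m → n < m′ → pow m v ≃ pow m′ v
  ≃-pow v n<m n<m′ = ≃-trans (≃-sym (canonical n<m)) (canonical n<m′)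
    where
    grow : ∀ i → pow (suc n) v ≃ pow (i + suc n) v
    grow zero = ≃-refl
    grow (suc i) = ≃-trans (grow i) (mk≃ λ x → ≈-pow-suc n (i + suc n) v x (m≤n+m (suc n) i))
    canonical : ∀ {m} → n < m → pow (suc n) v ≃ pow m v
    canonical {m} n<m = subst (λ m → pow (suc n) v ≃ pow m v) (m∸n+n≡m n<m) (grow (m ∸ suc n))

  -- The shortest n-block, headed by the symbol a. By `≃-pow` on the zeros, every longer n-block
  -- with this head is equivalent to it.
  block : ℕ → List ℕ
  block a = a ∷ replicate (suc n) 0

  blocks : List ℕ → List ℕ
  blocks = concatMap block

  blocks-++ : ∀ p q → blocks (p ++ q) ≡ blocks p ++ blocks q
  blocks-++ = concatMap-++ block

  blocks-pow : ∀ m q → blocks (pow m q) ≡ pow m (blocks q)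
  blocks-pow zero q = refl
  blocks-pow (suc m) q = trans (blocks-++ q (pow m q)) (cong (blocks q ++_) (blocks-pow m q))

  record _≋_ (p q : List ℕ) : Set where
    constructor mk≋
    field blocks-≃ : blocks p ≃ blocks q
  open _≋_ public

  ≋-refl : ∀ {p} → p ≋ p
  ≋-refl = mk≋ ≃-refl

  ≋-reflexive : ∀ {p q} → p ≡ q → p ≋ q
  ≋-reflexive refl = ≋-refl

  ≋-sym : ∀ {p q} → p ≋ q → q ≋ p
  ≋-sym (mk≋ e) = mk≋ (≃-sym e)

  ≋-trans : ∀ {p q r} → p ≋ q → q ≋ r → p ≋ r
  ≋-trans (mk≋ e) (mk≋ e′) = mk≋ (≃-trans e e′)

  ≋-++ : ∀ {p p′ q q′} → p ≋ p′ → q ≋ q′ → p ++ q ≋ p′ ++ q′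
  ≋-++ {p} {p′} {q} {q′} (mk≋ e) (mk≋ e′) =
    mk≋ (subst₂ _≃_ (sym (blocks-++ p q)) (sym (blocks-++ p′ q′)) (≃-++ e e′))

  ≋-pow : ∀ {m m′} q → n < m → n < m′ → pow m q ≋ pow m′ q
  ≋-pow {m} {m′} q n<m n<m′ =
    mk≋ (subst₂ _≃_ (sym (blocks-pow m q)) (sym (blocks-pow m′ q)) (≃-pow (blocks q) n<m n<m′))

  -- θ_(j+f) ⋯ θ_(j+1) (a) = a ∷ trail f j, for every a.
  trail : ℕ → ℕ → List ℕ
  trail zero j = []
  trail (suc f) j = trail f (suc j) ++ pow (4 + n) (suc j ∷ trail f (suc j))

  n<4+n : n < 4 + n
  n<4+n = m≤n+m (suc n) 3

  -- Induction on f, with the trail written τ v^N and v = (j+1) τ. If k = j + 1, the middle k τ is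
  -- one more v and the powers merge. If k is larger, the last v before k ends in τ, and τ k τ
  -- shrinks to τ by induction; again a power of v is left.
  absorb : ∀ f j k → j < k → k ≤ j + f → trail f j ++ k ∷ trail f j ≋ trail f j
  absorb zero j k j<k k≤j =
    contradiction (<-≤-trans j<k (subst (k ≤_) (+-identityʳ j) k≤j))
    (<-irrefl refl)
  absorb (suc f) j k j<k k≤ =
    ≋-trans (≋-reflexive (++-assoc τ (pow N v) _)) (≋-++ (≋-refl {τ}) (merge (m≤n⇒m<n∨m≡n j<k)))
    where
    τ = trail f (suc j)
    v = suc j ∷ τ
    N = 4 + n
    merge : suc j < k ⊎ suc j ≡ k → pow N v ++ k ∷ τ ++ pow N v ≋ pow N v
    merge (inj₂ refl) =
      ≋-trans (≋-reflexive (sym (pow-+ N (suc N) v)))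
              (≋-pow v (≤-trans n<4+n (m≤m+n N (suc N))) n<4+n)
    merge (inj₁ j+1<k) =
      ≋-trans (≋-reflexive (trans (cong (_++ (k ∷ τ ++ pow N v)) (pow-snoc (3 + n) v))
                  (++-assoc (pow (3 + n) v) v _)))
      (≋-trans (≋-++ (≋-refl {pow (3 + n) v})
         (≋-trans (≋-reflexive (cong (suc j ∷_) (sym (++-assoc τ (k ∷ τ) (pow N v)))))
           (≋-++ {suc j ∷ τ ++ k ∷ τ} {v} (≋-++ (≋-refl {suc j ∷ []})
             (absorb f (suc j) k j+1<k (subst (k ≤_) (+-suc j f) k≤))) (≋-refl {pow N v}))))
      (≋-trans (≋-reflexive (sym (pow-+ (3 + n) (suc N) v)))
               (≋-pow v (≤-trans (m≤n+m (suc n) 2) (m≤m+n (3 + n) (suc N))) n<4+n)))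

  -- First the N = n + 4 copies of q are replaced by N - 1. Then the trail T of the second copy is
  -- expanded to T k T, which restores N groups, the third now headed by k.
  hide-third : ∀ f k → 1 < k → k ≤ 1 + f → let q = 1 ∷ trail f 1 in
               pow (4 + n) q ≋ q ++ q ++ (k ∷ trail f 1) ++ pow (suc n) q
  hide-third f k 1<k k≤ = ≋-trans (≋-pow q n<4+n (m≤n+m (suc n) 2)) (≋-++ (≋-refl {q}) absorbed)
    where
    q = 1 ∷ trail f 1
    absorbed : q ++ pow (suc n) q ≋ q ++ (k ∷ trail f 1) ++ pow (suc n) q
    absorbed =
      ≋-trans (≋-++ {q} {q ++ k ∷ trail f 1}
                 (≋-++ (≋-refl {1 ∷ []}) (≋-sym (absorb f 1 k 1<k k≤))) (≋-refl {pow (suc n) q}))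
              (≋-reflexive (cong (1 ∷_) (++-assoc (trail f 1) _ _)))

-- The symbolic word of the fractal requirement

≢⇒≡ᵇ-false : ∀ m k → m ≢ k → (m ≡ᵇ k) ≡ false
≢⇒≡ᵇ-false m k m≢k with m ≡ᵇ k in e
... | false = refl
... | true = contradiction (≡ᵇ⇒≡ m k (subst T (sym e) _)) m≢k

≡ᵇ-refl : ∀ m → (m ≡ᵇ m) ≡ true
≡ᵇ-refl zero = refl
≡ᵇ-refl (suc m) = ≡ᵇ-refl m

-- Symbol j ≥ 1 stands for a position where only ξ_j carries p, symbol 0 for one where only η does;
-- so the label of path j (with η as path 0) at a position with symbol s is s ≡ᵇ j.
nonzero : ℕ → Bool
nonzero s = not (s ≡ᵇ 0)

symbol : ℕ → Bool → ℕ
symbol k true = k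
symbol k false = 0

-- How the symbolic word changes when w_(k+1) is joined: only a 0 may become the new symbol. The
-- bound in `keep` separates the old symbols from k + 1.
data Insert (k : ℕ) : ℕ → ℕ → Set where
  keep : ∀ {s} → s ≤ k → Insert k s s
  new  : Insert k 0 (suc k)

insert-old : ∀ {k j u u′} → 1 ≤ j → j ≤ k → Pointwise (Insert k) u u′ →
             map (_≡ᵇ j) u ≡ map (_≡ᵇ j) u′
insert-old 1≤j j≤k [] = refl
insert-old 1≤j j≤k (keep _ ∷ p) = cong (_ ∷_) (insert-old 1≤j j≤k p)
insert-old {k} {j} 1≤j j≤k (new ∷ p) =
  cong₂ _∷_ (trans (≢⇒≡ᵇ-false 0 j (<⇒≢ 1≤j))
                   (sym (≢⇒≡ᵇ-false (suc k) j (λ e → <⇒≢ (s≤s j≤k) (sym e)))))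
            (insert-old 1≤j j≤k p)

insert-join : ∀ {k u u′} → Pointwise (Insert k) u u′ →
              join₂ (map nonzero u) (map (_≡ᵇ suc k) u′) ≡ map nonzero u′
insert-join [] = refl
insert-join {k} (keep {s} s≤k ∷ p) = cong₂ _∷_
  (trans (cong (nonzero s ∨_) (≢⇒≡ᵇ-false s (suc k) (<⇒≢ (s≤s s≤k)))) (∨-identityʳ _))
  (insert-join p)
insert-join {k} (new ∷ p) = cong₂ _∷_ (≡ᵇ-refl k) (insert-join p)

insert-zeros : ∀ k (r : Word) → Pointwise (Insert k) (replicate (length r) 0) (map (symbol (suc k)) r)
insert-zeros k [] = []
insert-zeros k (true ∷ r) = new ∷ insert-zeros k r
insert-zeros k (false ∷ r) = keep z≤n ∷ insert-zeros k r

map-symbol : ∀ k (r : Word) → map (_≡ᵇ suc k) (map (symbol (suc k)) r) ≡ r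
map-symbol k [] = refl
map-symbol k (true ∷ r) = cong₂ _∷_ (≡ᵇ-refl k) (map-symbol k r)
map-symbol k (false ∷ r) = cong (false ∷_) (map-symbol k r)

nonzero-symbol : ∀ k (r : Word) → map nonzero (map (symbol (suc k)) r) ≡ r
nonzero-symbol k [] = refl
nonzero-symbol k (true ∷ r) = cong (true ∷_) (nonzero-symbol k r)
nonzero-symbol k (false ∷ r) = cong (false ∷_) (nonzero-symbol k r)

-- A run of ∅ ends at the first {p}, so a word determines its own block lengths.
falses-cancel : ∀ j j′ {X Y : Word} → replicate j false ++ true ∷ X ≡ replicate j′ false ++ true ∷ Y →
                j ≡ j′ × X ≡ Y
falses-cancel zero zero refl = refl , refl
falses-cancel (suc j) (suc j′) e with falses-cancel j j′ (∷-injectiveʳ e)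
... | refl , e′ = refl , e′

-- Symbolic words spelled in blocks, level by level

module Realisation (n : ℕ) where
  open Congruence n

  data Realises (k : ℕ) : List ℕ → List ℕ → Set where
    none : Realises k [] []
    add  : ∀ {a j q u} → 1 ≤ a → a ≤ k → suc n ≤ j → Realises k q u →
              Realises k (a ∷ q) (a ∷ replicate j 0 ++ u)

  realises-++⁺ : ∀ {k q q′ u u′} → Realises k q u → Realises k q′ u′ → Realises k (q ++ q′) (u ++ u′)
  realises-++⁺ none R′ = R′
  realises-++⁺ {u′ = u′} (add {a} {j} {u = u} l h z R) R′ =
    subst (Realises _ _) (cong (a ∷_) (sym (++-assoc (replicate j 0) u u′)))
      (add l h z (realises-++⁺ R R′))

  realises-++⁻ : ∀ {k} q {q′ u} → Realises k (q ++ q′) u →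
                 ∃₂ λ v v′ → u ≡ v ++ v′ × Realises k q v × Realises k q′ v′
  realises-++⁻ [] R = [] , _ , refl , none , R
  realises-++⁻ (a ∷ q) (add {j = j} l h z R) with realises-++⁻ q R
  ... | v , v′ , refl , S , S′ =
    a ∷ replicate j 0 ++ v , v′ , cong (a ∷_) (sym (++-assoc (replicate j 0) v v′)) , add l h z S , S′

  replicate≡pow : ∀ j → replicate j 0 ≡ pow j (0 ∷ [])
  replicate≡pow zero = refl
  replicate≡pow (suc j) = cong (0 ∷_) (replicate≡pow j)

  realises-≃ : ∀ {k q u} → Realises k q u → u ≃ blocks q
  realises-≃ none = ≃-refl
  realises-≃ (add {a} {j} l h z R) =
    ≃-++ {a ∷ replicate j 0} {block a} (≃-++ {a ∷ []} {a ∷ []} ≃-refl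
      (subst₂ _≃_ (sym (replicate≡pow j)) (sym (replicate≡pow (suc n))) (≃-pow (0 ∷ []) z ≤-refl)))
      (realises-≃ R)

  block-tail≥ : ∀ {j} → n + 2 ≤ suc j → suc n ≤ j
  block-tail≥ {j} z = +-cancelˡ-≤ 1 _ _ (subst (_≤ suc j) (+-comm n 2) z)

  realises-blocks : ∀ k {bls} → All (IsBlock n) bls →
    Realises (suc k) (replicate (length bls) (suc k)) (map (symbol (suc k)) (concat bls))
  realises-blocks k [] = none
  realises-blocks k {_ ∷ bls} ((j , z , refl) ∷ B) =
    subst (Realises _ _) (cong (suc k ∷_) (sym (trans (map-++ (symbol (suc k)) (replicate j false) _)
             (cong (_++ map (symbol (suc k)) (concat bls)) (map-replicate _ j false)))))
      (add (s≤s z≤n) ≤-refl (block-tail≥ z) (realises-blocks k B))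

  θ : ℕ → List ℕ → List ℕ
  θ k = concatMap (λ a → a ∷ replicate (4 + n) k)

  -- The closing {p} makes even an empty rest begin with `true`, so that `falses-cancel` also
  -- applies to the last block.
  blocks-lead : ∀ {bls} → All (IsBlock n) bls → ∃ λ X → concat bls ++ true ∷ [] ≡ true ∷ X
  blocks-lead [] = [] , refl
  blocks-lead ((j , _ , refl) ∷ B) = _ , refl

  realises-lead : ∀ {k q u} → Realises k q u → ∃ λ X → map nonzero u ++ true ∷ [] ≡ true ∷ X
  realises-lead none = [] , refl
  realises-lead (add (s≤s _) _ _ R) = _ , refl

  -- Comparing joins shows that the blocks of the fractal requirement are those of u. A replacement
  -- begins with ∅, so each head symbol survives, and its {p}s fall on zeros of u, where they become
  -- k + 1.
  refine : ∀ {k q u bls rs} → Realises k q u → All (IsBlock n) bls →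
    map nonzero u ++ true ∷ [] ≡ concat bls ++ true ∷ [] → Pointwise (Replacement n) bls rs →
    ∃ λ u′ → Realises (suc k) (θ (suc k) q) u′ × Pointwise (Insert k) u u′ ×
             map (_≡ᵇ suc k) u′ ≡ concat rs
  refine none [] e [] = [] , none , [] , refl
  refine none ((suc j , _ , refl) ∷ B) () _
  refine none ((zero , z , refl) ∷ B) e _ = contradiction (block-tail≥ z) λ ()
  refine (add (s≤s _) _ (s≤s _) R) [] () _
  refine (add _ _ _ _) (_ ∷ _) _ ((_ , zero , _ , m≥ , _) ∷ _) =
    contradiction (block-tail≥ (m≤n⇒m≤1+n m≥)) λ ()
  -- Of the `suc m` leading ∅s one lies under the head a; the other m ≥ n + 1 still form a block
  -- with head a, followed by n + 4 blocks with head k + 1.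
  refine {k} {a ∷ q} (add {j = j} {u = u} l@(s≤s _) h z R)
    (_∷_ {xs = bls} (j′ , z′ , refl) B) e (_∷_ {ys = rs} (len , suc m , bs , m≥ , Bs , N , refl) P)
    with realises-lead R | blocks-lead B
  ... | X , eX | Y , eY
    with falses-cancel j j′ (begin
      replicate j false ++ true ∷ X ≡⟨ cong (replicate j false ++_) (sym eX) ⟩
      replicate j false ++ map nonzero u ++ true ∷ [] ≡⟨ sym (++-assoc (replicate j false) _ _) ⟩
      (replicate j false ++ map nonzero u) ++ true ∷ []
        ≡⟨ cong (λ v → (v ++ map nonzero u) ++ true ∷ []) (sym (map-replicate nonzero j 0)) ⟩
      (map nonzero (replicate j 0) ++ map nonzero u) ++ true ∷ []
        ≡⟨ cong (_++ true ∷ []) (sym (map-++ nonzero (replicate j 0) u)) ⟩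
      map nonzero (replicate j 0 ++ u) ++ true ∷ [] ≡⟨ ∷-injectiveʳ e ⟩
      (replicate j′ false ++ concat bls) ++ true ∷ [] ≡⟨ ++-assoc (replicate j′ false) _ _ ⟩
      replicate j′ false ++ concat bls ++ true ∷ [] ≡⟨ cong (replicate j′ false ++_) eY ⟩
      replicate j′ false ++ true ∷ Y ∎)
    where open ≡-Reasoning
  ... | refl , X≡Y with refine R B (trans eX (trans (cong (true ∷_) X≡Y) (sym eY))) P
  ... | u′ , R′ , I , e′ =
    (a ∷ map σ r) ++ u′ ,
    realises-++⁺ {q = a ∷ replicate (4 + n) (suc k)} realised R′ ,
    Pointwise.++⁺ (keep h ∷ subst (λ i → Pointwise (Insert k) (replicate i 0) (map σ r)) lenʳ
                            (insert-zeros k r)) I ,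
    trans (map-++ (_≡ᵇ suc k) (a ∷ map σ r) u′)
      (cong₂ _++_ (cong₂ _∷_ (≢⇒≡ᵇ-false a (suc k) (<⇒≢ (s≤s h))) (map-symbol k r)) e′)
    where
    σ = symbol (suc k)
    r = replicate m false ++ concat bs
    lenʳ : length r ≡ j
    lenʳ = trans (suc-injective len) (length-replicate j)
    realised : Realises (suc k) (a ∷ replicate (4 + n) (suc k)) (a ∷ map σ r)
    realised = subst₂ (λ i v → Realises (suc k) (a ∷ replicate i (suc k)) (a ∷ v))
      (trans N (+-comm n 4))
      (sym (trans (map-++ σ (replicate m false) (concat bs))
                  (cong (_++ map σ (concat bs)) (map-replicate σ m false))))
      (add l (m≤n⇒m≤1+n h) (block-tail≥ m≥) (realises-blocks k Bs))

  -- One word over 0, ..., k encodes w_1, ..., w_k at once. The final 1 is the closing {p}, which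
  -- comes from w_1.
  Level : (ℕ → Word) → ℕ → List ℕ → Set
  Level w k q = ∃ λ u → Realises k q u × joinUpTo w k ≡ map nonzero (u ++ 1 ∷ []) ×
                       (∀ j → 1 ≤ j → j ≤ k → w j ≡ map (_≡ᵇ j) (u ++ 1 ∷ []))

  level-one : ∀ {w} → FractalReq n w → 1 ≤ n → Level w 1 (replicate (4 + n) 1)
  level-one {w} fr 1≤n with fr 1 ≤-refl 1≤n
  ... | bls , B , e , len , _ = map (symbol 1) (concat bls) ,
    subst (λ i → Realises 1 (replicate i 1) (map (symbol 1) (concat bls)))
      (trans (len refl) (+-comm n 4)) (realises-blocks 0 B) ,
    trans e (trans (cong (_++ true ∷ []) (sym (nonzero-symbol 0 (concat bls))))
              (sym (map-++ nonzero (map (symbol 1) (concat bls)) _))) ,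
    λ { (suc zero) _ _ →  trans e (trans (cong (_++ true ∷ []) (sym (map-symbol 0 (concat bls))))
              (sym (map-++ (_≡ᵇ 1) (map (symbol 1) (concat bls)) _))) ; (suc (suc j)) _ (s≤s ()) }

  level-suc : ∀ {w k q} → FractalReq n w → 1 ≤ k → k < n → Level w k q → Level w (suc k) (θ (suc k) q)
  level-suc {w} {k@(suc k′)} fr 1≤k k<n (u , R , eJ , eW) with fr k 1≤k (<⇒≤ k<n)
  ... | bls , B , e , _ , next with next k<n
  ... | rs , P , eR with refine R B (trans (sym (map-++ nonzero u _)) (trans (sym eJ) e)) P
  ... | u′ , R′ , I , e′ = u′ , R′ ,
    trans (cong₂ join₂ eJ wk) (insert-join I⁺) , words
    where
    I⁺ : Pointwise (Insert k) (u ++ 1 ∷ []) (u′ ++ 1 ∷ [])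
    I⁺ = Pointwise.++⁺ I (keep 1≤k ∷ [])
    wk : w (suc k) ≡ map (_≡ᵇ suc k) (u′ ++ 1 ∷ [])
    wk = trans eR (trans (cong (_++ false ∷ []) (sym e′)) (sym (map-++ (_≡ᵇ suc k) u′ _)))
    words : ∀ j → 1 ≤ j → j ≤ suc k → w j ≡ map (_≡ᵇ j) (u′ ++ 1 ∷ [])
    words j 1≤j j≤ with m≤n⇒m<n∨m≡n j≤
    ... | inj₁ (s≤s j≤k) = trans (eW j 1≤j j≤k) (insert-old 1≤j j≤k I⁺)
    ... | inj₂ refl = wk

  concatMap-replicate : ∀ (g : ℕ → List ℕ) m a → concatMap g (replicate m a) ≡ pow m (g a)
  concatMap-replicate g m a = cong concat (map-replicate g m a)

  concatMap-trail : ∀ f j q → concatMap (λ a → a ∷ trail f (suc j)) (θ (suc j) q)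
                              ≡ concatMap (λ a → a ∷ trail (suc f) j) q
  concatMap-trail f j [] = refl
  concatMap-trail f j (a ∷ q) =
    trans (concatMap-++ g (a ∷ replicate (4 + n) (suc j)) (θ (suc j) q))
      (cong₂ _++_ (cong (λ v → a ∷ trail f (suc j) ++ v) (concatMap-replicate g (4 + n) (suc j)))
                  (concatMap-trail f j q))
    where
    g : ℕ → List ℕ
    g a = a ∷ trail f (suc j)

  -- f counts the levels still to come; their substitutions compose to appending a trail to every
  -- letter.
  level-top : ∀ f {w k q} → FractalReq n w → 1 ≤ k → k + f ≡ n → Level w k q →
              Level w n (concatMap (λ a → a ∷ trail f k) q)
  level-top zero {w} {k} {q} fr 1≤k e L =
    subst₂ (Level w) (trans (sym (+-identityʳ k)) e) (sym (concat-map-[ q ])) L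
  level-top (suc f) {w} {k} {q} fr 1≤k e L =
    subst (Level w n) (concatMap-trail f k q)
      (level-top f fr (s≤s z≤n) (trans (sym (+-suc k f)) e)
        (level-suc fr 1≤k (subst (k <_) e (m<m+n k (s≤s z≤n))) L))

  fractal-word : ∀ f {w} → FractalReq n w → suc f ≡ n → Level w n (pow (4 + n) (1 ∷ trail f 1))
  fractal-word f {w} fr refl =
    subst (Level w n) (concatMap-replicate (λ a → a ∷ trail f 1) (4 + n) 1)
      (level-top f fr ≤-refl refl (level-one fr (s≤s z≤n)))

-- Transfer of satisfaction between structures branching only at the root

-- Pigeonhole: while the candidate m occurs in l, deleting it shortens l and the search goes on from
-- m + 1.
fresh : ∀ m (l : List ℕ) → ∃ λ k → m ≤ k × k ≤ m + length l × k ∉ l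
fresh m l = search (length l) m l ≤-refl
  where
  search : ∀ c m l → length l ≤ c → ∃ λ k → m ≤ k × k ≤ m + c × k ∉ l
  search c m l len with m ∈? l
  ... | no m∉l = m , ≤-refl , m≤m+n m c , m∉l
  search zero m (_ ∷ _) () | yes m∈l
  search (suc c) m l len | yes m∈l
    with search c (suc m) (filter (λ x → ¬? (x ≟ m)) l)
           (≤-pred (≤-trans (filter-notAll (λ x → ¬? (x ≟ m)) l (Any.map (λ e ne → ne (sym e)) m∈l)) len))
  ... | k , m<k , k≤ , k∉ = k , <⇒≤ m<k , subst (k ≤_) (sym (+-suc m c)) k≤ ,
    λ k∈l → k∉ (∈-filter⁺ (λ x → ¬? (x ≟ m)) k∈l (λ e → <⇒≢ m<k (sym e)))

-- The tree seen as n + 1 indexed paths. Labels depend only on the index, and `split` expresses that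
-- there is no branching beyond the root.
record PathSystem (n : ℕ) (K : Kripke) (L : ℕ → ℕ → Bool) : Set where
  open Kripke K
  field
    index      : InitPath K → ℕ
    index≤     : ∀ π → index π ≤ n
    path       : ℕ → InitPath K
    index-path : ∀ {j} → j ≤ n → index (path j) ≡ j
    label      : ∀ π i → V (seq π i) ≡ L (index π) i
    same-root  : ∀ (π π′ : InitPath K) → seq π 0 ≡ seq π′ 0
    split      : ∀ (π π′ : InitPath K) → seq π 1 ≡ seq π′ 1 → index π ≡ index π′

open PathSystem

-- A position where only the hidden path k carries p and one where no path does are both written k.
record Describes (n k : ℕ) (L : ℕ → ℕ → Bool) (σ : Stream) : Set where
  field symbol-at : ∀ j → j ≤ n → j ≢ k → ∀ i → L j (suc i) ≡ (σ i ≡ᵇ j)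

open Describes

Agree : ∀ {n K K′ L L′} → PathSystem n K L → PathSystem n K′ L′ →
        List Var → Assignment K → Assignment K′ → Set
Agree P P′ Γ Π Π′ = ∀ {x} → x ∈ Γ → index P (Π x) ≡ index P′ (Π′ x)

agree-update : ∀ {n K K′ L L′} (P : PathSystem n K L) (P′ : PathSystem n K′ L′) {Γ Π Π′} x {π π′} →
  Agree P P′ Γ Π Π′ → index P π ≡ index P′ π′ →
  Agree P P′ (x ∷ Γ) (update {K} Π x π) (update {K′} Π′ x π′)
agree-update P P′ x A e {z} z∈ with z ≡ᵇ x in z≡x
... | true = e
agree-update P P′ x A e {.x} (here refl) | false = contradiction (trans (sym (≡ᵇ-refl x)) z≡x) λ ()
agree-update P P′ x A e {z} (there z∈) | false = A z∈

Avoids : ∀ {n K L} → PathSystem n K L → ℕ → List Var → Assignment K → Set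
Avoids P k Γ Π = ∀ {x} → x ∈ Γ → index P (Π x) ≢ k

avoids-update : ∀ {n K L} (P : PathSystem n K L) {k Γ Π} x {π} →
  Avoids P k Γ Π → index P π ≢ k → Avoids P k (x ∷ Γ) (update {K} Π x π)
avoids-update P x A e {z} z∈ with z ≡ᵇ x in z≡x
... | true = e
avoids-update P x A e {.x} (here refl) | false = contradiction (trans (sym (≡ᵇ-refl x)) z≡x) λ ()
avoids-update P x A e {z} (there z∈) | false = A z∈

drop-+ : ∀ d i m (x : Stream) → drop m (drop i x) ≈[ d ] drop (i + m) x
drop-+ d i m x = ≈-ext d (λ t → cong x (sym (+-assoc i m t)))

≈-next : ∀ {d} x y i i′ → drop i x ≈[ suc d ] drop i′ y → drop (suc i) x ≈[ d ] drop (suc i′) y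
≈-next {d} x y i i′ (later _ t _ _) =
  ≈-trans (≈-ext d (λ s → cong x (sym (+-suc i s)))) (≈-trans t (≈-ext d (λ s → cong y (+-suc i′ s))))

≈-until : ∀ {d} x y i i′ → drop i x ≈[ suc d ] drop i′ y → ∀ m → ∃ λ m′ →
  drop (i + m) x ≈[ d ] drop (i′ + m′) y ×
  (∀ r′ → r′ < m′ → ∃ λ r → r < m × drop (i + r) x ≈[ d ] drop (i′ + r′) y)
≈-until {d} x y i i′ (later _ _ f _) m with f m
... | m′ , p , ps = m′ , rebase m m′ p , λ r′ r′<m′ →
  let (r , r<m , q) = ps r′ r′<m′ in r , r<m , rebase r r′ q
  where
  rebase : ∀ m m′ → drop m (drop i x) ≈[ d ] drop m′ (drop i′ y) →
           drop (i + m) x ≈[ d ] drop (i′ + m′) y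
  rebase m m′ p = ≈-trans (≈-sym (drop-+ d i m x)) (≈-trans p (drop-+ d i′ m′ y))

-- Beyond the root a quantifier can only pick the path already followed, so no variable ever moves
-- to the hidden path k and the two streams decide the formula. Position i + 1 of a path reads
-- symbol i, the root having none.
sat-beyond-root : ∀ {n k K K′ L L′ σ σ′} (P : PathSystem n K L) (P′ : PathSystem n K′ L′) →
  Describes n k L σ → Describes n k L′ σ′ →
  ∀ φ {Γ d Π Π′ y i i′} → Closed Γ φ → y ∈ Γ → Agree P P′ Γ Π Π′ → Avoids P k Γ Π →
  size φ ≤ d → drop i σ ≈[ d ] drop i′ σ′ → Sat K φ Π y (suc i) → Sat K′ φ Π′ y (suc i′)
sat-beyond-root P P′ D D′ ⊤ᶠ cl y∈ A V len E s = tt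
sat-beyond-root {σ = σ} {σ′} P P′ D D′ p[ x ] {Π = Π} {Π′} {i = i} {i′} cl y∈ A V len E s = begin
  _ ≡⟨ label P′ (Π′ x) (suc i′) ⟩
  _ ≡⟨ symbol-at D′ (index P′ (Π′ x)) (index≤ P′ _) (subst (_≢ _) (A cl) (V cl)) i′ ⟩
  (σ′ i′ ≡ᵇ index P′ (Π′ x)) ≡⟨ cong₂ _≡ᵇ_ head (A cl) ⟨
  (σ i ≡ᵇ index P (Π x)) ≡⟨ symbol-at D (index P (Π x)) (index≤ P _) (V cl) i ⟨
  _ ≡⟨ label P (Π x) (suc i) ⟨
  _ ≡⟨ s ⟩
  true ∎
  where
  open ≡-Reasoning
  head : σ i ≡ σ′ i′
  head = trans (cong σ (sym (+-identityʳ i))) (trans (≈-head E) (cong σ′ (+-identityʳ i′)))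
sat-beyond-root P P′ D D′ (¬ᶠ φ) cl y∈ A V len E s s′ =
  s (sat-beyond-root P′ P D′ D φ cl y∈ (λ x∈ → sym (A x∈)) (λ x∈ e → V x∈ (trans (A x∈) e))
       (<⇒≤ len) (≈-sym E) s′)
sat-beyond-root P P′ D D′ (φ ∧ᶠ ψ) (clφ , clψ) y∈ A V len E (s , s′) =
  sat-beyond-root P P′ D D′ φ clφ y∈ A V (≤-trans (m≤m+n _ _) (<⇒≤ len)) E s ,
  sat-beyond-root P P′ D D′ ψ clψ y∈ A V (≤-trans (m≤n+m _ (size φ)) (<⇒≤ len)) E s′
sat-beyond-root {σ = σ} {σ′} P P′ D D′ (Xᶠ φ) {i = i} {i′} cl y∈ A V (s≤s len) E s =
  sat-beyond-root P P′ D D′ φ cl y∈ A V len (≈-next σ σ′ i i′ E) s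
sat-beyond-root {K′ = K′} {σ = σ} {σ′} P P′ D D′ (φ Uᶠ ψ) {d = suc d} {Π = Π} {Π′} {y} {i} {i′}
  (clφ , clψ) y∈ A V (s≤s len) E (suc k , s≤s i≤k , sψ , sφ) with m≤n⇒∃[o]m+o≡n i≤k
... | m , refl with ≈-until σ σ′ i i′ E m
... | m′ , p , ps =
  suc (i′ + m′) , s≤s (m≤m+n i′ m′) ,
  sat-beyond-root P P′ D D′ ψ clψ y∈ A V (≤-trans (m≤n+m _ (size φ)) len) p sψ , before
  where
  before : ∀ j → suc i′ ≤ j → j < suc (i′ + m′) → Sat K′ φ Π′ y j
  before (suc j) (s≤s i′≤j) (s≤s j<) with m≤n⇒∃[o]m+o≡n i′≤j
  ... | r′ , refl with ps r′ (+-cancelˡ-< i′ r′ m′ j<)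
  ... | r , r<m , q = sat-beyond-root P P′ D D′ φ clφ y∈ A V (≤-trans (m≤m+n _ _) len) q
                        (sφ (suc (i + r)) (s≤s (m≤m+n i r)) (s≤s (+-monoʳ-< i r<m)))
sat-beyond-root P P′ D D′ (∃ᶠ x ∙ φ) {Π = Π} {Π′} {y} cl y∈ A V len E (π , same , s) =
  Π′ y , (λ _ _ → refl) ,
  sat-beyond-root P P′ D D′ φ cl (here refl)
    (agree-update P P′ x {π} {Π′ y} A (trans e (A y∈)))
    (avoids-update P x {π} V (λ e′ → V y∈ (trans (sym e) e′)))
    (<⇒≤ len) E s
  where
  e : index P π ≡ index P (Π y)
  e = split P π (Π y) (same 1 (s≤s z≤n))

-- The streams in `hide` may depend on k, since the changed position of M_n is going to be written
-- k.
record Indistinguishable (n : ℕ) (L L′ : ℕ → ℕ → Bool) : Set where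
  field
    root≡ : ∀ j → j ≤ n → L j 0 ≡ L′ j 0
    hide  : ∀ k → 2 ≤ k → k ≤ n →
            ∃₂ λ σ σ′ → Describes n k L σ × Describes n k L′ σ′ × σ ≈[ n ] σ′

open Indistinguishable

indistinguishable-sym : ∀ {n L L′} → Indistinguishable n L L′ → Indistinguishable n L′ L
indistinguishable-sym I = record
  { root≡ = λ j j≤n → sym (root≡ I j j≤n)
  ; hide = λ k 2≤k k≤n → let (σ , σ′ , D , D′ , E) = hide I k 2≤k k≤n in σ′ , σ , D′ , D , ≈-sym E
  }

-- At most n - 2 variables are in scope, so some index between 2 and n is held by none of them and
-- can stay hidden for the rest of the evaluation.
sat-after-root : ∀ {n K K′ L L′} (P : PathSystem n K L) (P′ : PathSystem n K′ L′) →
  Indistinguishable n L L′ →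
  ∀ φ {Γ Π Π′ y} → Closed Γ φ → y ∈ Γ → Agree P P′ Γ Π Π′ → size φ + length Γ ≤ n → 2 + length Γ ≤ n →
  Sat K φ Π y 1 → Sat K′ φ Π′ y 1
sat-after-root {n} P P′ I φ {Γ} {Π} cl y∈ A len len₂ s with fresh 2 (map (λ x → index P (Π x)) Γ)
... | k , 2≤k , k≤ , k∉
  with hide I k 2≤k (≤-trans k≤ (subst (λ m → 2 + m ≤ n) (sym (length-map _ Γ)) len₂))
... | σ , σ′ , D , D′ , E =
  sat-beyond-root P P′ D D′ φ cl y∈ A
    (λ x∈ e → k∉ (subst (_∈ map (λ x → index P (Π x)) Γ) e (∈-map⁺ (λ x → index P (Π x)) x∈)))
    (≤-trans (m≤m+n _ _) len) E s

-- A quantifier at the root is answered by the path of the same index. It trades one unit of size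
-- for one variable, so size plus number of variables stays below n. `Guarded` ensures that the
-- current variable is bound before a temporal operator leaves the root.
sat-at-root : ∀ {n K K′ L L′} (P : PathSystem n K L) (P′ : PathSystem n K′ L′) →
  Indistinguishable n L L′ →
  ∀ b φ {Γ Π Π′ y} → Closed Γ φ → Guarded b φ → (T b → y ∈ Γ) → Agree P P′ Γ Π Π′ →
  size φ + length Γ < n → Sat K φ Π y 0 → Sat K′ φ Π′ y 0
sat-at-root P P′ I b ⊤ᶠ cl g y∈ A len s = tt
sat-at-root {L′ = L′} P P′ I b p[ x ] {Π = Π} {Π′} cl g y∈ A len s = begin
  _ ≡⟨ label P′ (Π′ x) 0 ⟩
  _ ≡⟨ cong (λ j → L′ j 0) (A cl) ⟨
  _ ≡⟨ root≡ I _ (index≤ P (Π x)) ⟨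
  _ ≡⟨ label P (Π x) 0 ⟨
  _ ≡⟨ s ⟩
  true ∎
  where open ≡-Reasoning
sat-at-root P P′ I b (¬ᶠ φ) cl g y∈ A len s s′ =
  s (sat-at-root P′ P (indistinguishable-sym I) b φ cl g y∈ (λ x∈ → sym (A x∈)) (<⇒≤ len) s′)
sat-at-root P P′ I b (φ ∧ᶠ ψ) {Γ} (clφ , clψ) (gφ , gψ) y∈ A len (s , s′) =
  sat-at-root P P′ I b φ clφ gφ y∈ A
    (≤-<-trans (+-monoˡ-≤ (length Γ) (m≤n⇒m≤1+n (m≤m+n _ _))) len) s ,
  sat-at-root P P′ I b ψ clψ gψ y∈ A
    (≤-<-trans (+-monoˡ-≤ (length Γ) (m≤n⇒m≤1+n (m≤n+m _ (size φ)))) len) s′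
sat-at-root P P′ I b (Xᶠ φ) {Γ} cl (tb , g) y∈ A len s =
  sat-after-root P P′ I φ cl (y∈ tb) A (≤-trans (n≤1+n _) (<⇒≤ len))
    (≤-trans (s≤s (s≤s (m≤n+m _ (size φ)))) len) s
sat-at-root P P′ I b (φ Uᶠ ψ) {Γ} (clφ , clψ) (tb , gφ , gψ) y∈ A len (zero , _ , sψ , _) =
  0 , z≤n ,
  sat-at-root P P′ I b ψ clψ gψ y∈ A
    (≤-<-trans (+-monoˡ-≤ (length Γ) (m≤n⇒m≤1+n (m≤n+m _ (size φ)))) len) sψ ,
  λ _ _ ()
sat-at-root {K′ = K′} P P′ I b (φ Uᶠ ψ) {Γ} {Π′ = Π′} {y} (clφ , clψ) (tb , gφ , gψ) y∈ A len
  (suc k , _ , sψ , sφ)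
  -- The whole until is moved to position 1, so that one hidden path serves φ and ψ together;
  -- position 0 is settled separately in `before`.
  with sat-after-root P P′ I (φ Uᶠ ψ) (clφ , clψ) (y∈ tb) A (<⇒≤ len)
         (≤-trans (s≤s (s≤s (m≤n+m _ (size φ + size ψ)))) len)
         (suc k , s≤s z≤n , sψ , λ j _ → sφ j z≤n)
... | k′ , 1≤k′ , sψ′ , sφ′ = k′ , z≤n , sψ′ , before
  where
  before : ∀ j → 0 ≤ j → j < k′ → Sat K′ φ Π′ y j
  before zero _ _ = sat-at-root P P′ I b φ clφ gφ y∈ A
    (≤-<-trans (+-monoˡ-≤ (length Γ) (m≤n⇒m≤1+n (m≤m+n _ _))) len) (sφ 0 z≤n (s≤s z≤n))
  before (suc j) _ j<k′ = sφ′ (suc j) (s≤s z≤n) j<k′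
sat-at-root {n} P P′ I b (∃ᶠ x ∙ φ) {Γ} {Π} {Π′} {y} cl g y∈ A len (π , _ , s) =
  path P′ (index P π) , (λ { zero _ → same-root P′ (path P′ (index P π)) (Π′ y) }) ,
  sat-at-root P P′ I true φ cl g (λ _ → here refl)
    (agree-update P P′ {Γ} {Π} {Π′} x {π} A (sym (index-path P′ (index≤ P π))))
    (subst (_< n) (sym (+-suc (size φ) (length Γ))) len) s

models-transfer : ∀ {n K K′ L L′} → PathSystem n K L → PathSystem n K′ L′ → Indistinguishable n L L′ →
  ∀ ψ → Sentence ψ → size ψ < n → Models K ψ → Models K′ ψ
models-transfer {n} P P′ I ψ (cl , g) len (Π , y , s) =
  (λ x → path P′ (index P (Π x))) , y ,
  sat-at-root P P′ I false ψ cl g (λ ()) (λ ()) (subst (_< n) (sym (+-identityʳ (size ψ))) len) s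

-- The structures K_n and M_n

Third : (ℕ → Bool) → ℕ → Set
Third L c = L c ≡ true × ∃₂ λ a b →
  1 ≤ a × a < b × b < c × L a ≡ true × L b ≡ true ×
  (∀ j → 1 ≤ j → j < c → L j ≡ true → j ≡ a ⊎ j ≡ b)

-- Otherwise a, b and c would be three distinct positions before c′, where only two are allowed.
third-not-before : ∀ {L c c′} → Third L c → Third L c′ → ¬ c < c′
third-not-before (Lc , a , b , 1≤a , a<b , b<c , La , Lb , _) (_ , a′ , b′ , _ , _ , _ , _ , _ , only)
  c<c′
  with only a 1≤a (<-trans a<b (<-trans b<c c<c′)) La
     | only b (≤-trans 1≤a (<⇒≤ a<b)) (<-trans b<c c<c′) Lb
     | only _ (≤-trans 1≤a (<⇒≤ (<-trans a<b b<c))) c<c′ Lc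
... | inj₁ refl | inj₁ refl | _         = <-irrefl refl a<b
... | inj₂ refl | inj₂ refl | _         = <-irrefl refl a<b
... | _         | inj₁ refl | inj₁ refl = <-irrefl refl b<c
... | _         | inj₂ refl | inj₂ refl = <-irrefl refl b<c
... | inj₁ refl | inj₂ refl | inj₁ refl = <-irrefl refl (<-trans a<b b<c)
... | inj₂ refl | inj₁ refl | inj₂ refl = <-irrefl refl (<-trans a<b b<c)

third-unique : ∀ {L c c′} → Third L c → Third L c′ → c ≡ c′
third-unique {L} {c} {c′} t t′ with <-cmp c c′
... | tri< c<c′ _ _ = contradiction c<c′ (third-not-before {L} t t′)
... | tri≈ _ c≡c′ _ = c≡c′
... | tri> _ _ c′<c = contradiction c′<c (third-not-before {L} t′ t)

⊕-after : ∀ u k x → (u ⊕ x) (length u + k) ≡ x k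
⊕-after [] k x = refl
⊕-after (_ ∷ u) k x = ⊕-after u k x

⊕-cong : ∀ u {x y : Stream} i → (∀ r → i ≡ length u + r → x r ≡ y r) → (u ⊕ x) i ≡ (u ⊕ y) i
⊕-cong [] i e = e i refl
⊕-cong (_ ∷ u) zero e = refl
⊕-cong (_ ∷ u) (suc i) e = ⊕-cong u i (λ r i≡ → e r (cong suc i≡))

⊕-only-head : ∀ {a u} x i → All (_≢ a) u → i < length (a ∷ u) → ((a ∷ u) ⊕ x) i ≡ a → i ≡ 0
⊕-only-head x zero _ _ _ = refl
⊕-only-head x (suc i) A (s≤s i<) e = contradiction e (avoid i A i<)
  where
  avoid : ∀ {u} i → All (_≢ _) u → i < length u → (u ⊕ x) i ≢ _
  avoid zero (a ∷ _) _ = a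
  avoid (suc i) (_ ∷ A) (s≤s i<) = avoid i A i<

-- Since u and v hold no 1, the three displayed heads are the first three 1s. The outer `suc`
-- accounts for the root at position 0.
third-one : ∀ {u v} x → All (_≢ 1) u → All (_≢ 1) v → {L : ℕ → Bool} → let u₁ = 1 ∷ u; v₁ = 1 ∷ v in
  (∀ i → L (suc i) ≡ ((u₁ ⊕ v₁ ⊕ 1 ∷ˢ x) i ≡ᵇ 1)) →
  Third L (suc (length u₁ + (length v₁ + 0)))
third-one {u} {v} x A B {L} e =
  lift c (trans (⊕-after u₁ _ _) (⊕-after v₁ 0 _)) ,
  1 , suc b , s≤s z≤n , s≤s (s≤s z≤n) ,
  s≤s (+-monoʳ-< (length u₁) (s≤s z≤n)) , lift 0 refl , lift b (⊕-after u₁ 0 (v₁ ⊕ 1 ∷ˢ x)) , only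
  where
  u₁ = 1 ∷ u
  v₁ = 1 ∷ v
  σ = u₁ ⊕ v₁ ⊕ 1 ∷ˢ x
  b = length u₁ + 0
  c = length u₁ + (length v₁ + 0)
  lift : ∀ i → σ i ≡ 1 → L (suc i) ≡ true
  lift i σi = trans (e i) (cong (_≡ᵇ 1) σi)
  lower : ∀ i → L (suc i) ≡ true → σ i ≡ 1
  lower i Li = ≡ᵇ⇒≡ _ _ (subst T (trans (sym Li) (e i)) tt)
  only : ∀ j → 1 ≤ j → j < suc c → L j ≡ true → j ≡ 1 ⊎ j ≡ suc b
  only (suc i) _ (s≤s i<c) Li with i <? length u₁
  ... | yes i< = inj₁ (cong suc (⊕-only-head _ i A i< (lower i Li)))
  ... | no i≮ with m≤n⇒∃[o]m+o≡n (≮⇒≥ i≮)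
  ... | r , refl = inj₂ (cong (λ s → suc (length u₁ + s))
          (⊕-only-head (1 ∷ˢ x) r B (subst (r <_) (+-identityʳ _) (+-cancelˡ-< (length u₁) r _ i<c))
            (trans (sym (⊕-after u₁ r _)) (lower _ Li))))

-- Beyond the words only η carries p, which is symbol 0 for ever.
zeros : Stream
zeros _ = 0

-- The default `0 ≡ᵇ j` is {p} for η and ∅ for every ξ_k, as in the two kinds of lasso.
nthOr-map : ∀ j (s : List ℕ) i → nthOr (0 ≡ᵇ j) (map (_≡ᵇ j) s) i ≡ ((s ⊕ zeros) i ≡ᵇ j)
nthOr-map j [] i = refl
nthOr-map j (a ∷ s) zero = refl
nthOr-map j (a ∷ s) (suc i) = nthOr-map j s i

module Shape (n : ℕ) where
  open Congruence n
  open Realisation n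

  -- For j = 1 this leaves the heads of the groups `1 ∷ trail f 1` as the only 1s, which locates the
  -- third one.
  trail-above : ∀ f j → All (j <_) (trail f j)
  trail-above zero j = []
  trail-above (suc f) j = All.++⁺ deeper (pow-above (4 + n))
    where
    deeper : All (j <_) (trail f (suc j))
    deeper = All.map <⇒≤ (trail-above f (suc j))
    pow-above : ∀ m → All (j <_) (pow m (suc j ∷ trail f (suc j)))
    pow-above zero = []
    pow-above (suc m) = All.++⁺ (≤-refl ∷ deeper) (pow-above m)

  realises-no-one : ∀ {k q u} → All (1 <_) q → Realises k q u → All (_≢ 1) u
  realises-no-one [] none = []
  realises-no-one (1<a ∷ A) (add {j = j} _ _ _ R) =
    (λ e → <⇒≢ 1<a (sym e)) ∷ All.++⁺ (All.replicate⁺ j (λ ())) (realises-no-one A R)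

  realises-one : ∀ {k} f {u} → Realises k (1 ∷ trail f 1) u → ∃ λ v → u ≡ 1 ∷ v × All (_≢ 1) v
  realises-one f (add {j = j} _ _ _ R) =
    _ , refl , All.++⁺ (All.replicate⁺ j (λ ())) (realises-no-one (trail-above f 1) R)

  record Split (f : ℕ) (s : List ℕ) : Set where
    field
      u v : List ℕ
      x   : Stream
      u-no-one : All (_≢ 1) u
      v-no-one : All (_≢ 1) v
      shape : s ⊕ 1 ∷ˢ zeros ≡ (1 ∷ u) ⊕ (1 ∷ v) ⊕ 1 ∷ˢ x
      hidden : ∀ k → 1 < k → k ≤ 1 + f → k ≤ n →
        (1 ∷ u) ⊕ (1 ∷ v) ⊕ 1 ∷ˢ x ≈[ n ] (1 ∷ u) ⊕ (1 ∷ v) ⊕ k ∷ˢ x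

  split-third : ∀ f {s} → Realises n (pow (4 + n) (1 ∷ trail f 1)) s → Split f s
  split-third f R with realises-++⁻ (1 ∷ trail f 1) R
  ... | u₁ , _ , refl , Ru , R₁ with realises-++⁻ (1 ∷ trail f 1) R₁
  ... | v₁ , _ , refl , Rv , add {j = j} {u = s} 1≤1 1≤n n<j R₂
    with realises-one f Ru | realises-one f Rv
  ... | u , refl , A | v , refl , B = record
    { u = u ; v = v ; x = (replicate j 0 ++ s) ⊕ 1 ∷ˢ zeros
    ; u-no-one = A ; v-no-one = B
    ; shape = regroup 1
    -- Pass to the block word, apply `hide-third`, and return to a word with the original runs of
    -- zeros, its third 1 replaced by k.
    ; hidden = λ k 1<k k≤1+f k≤n → subst₂ _≈[ n ]_ (regroup 1) (regroup k)
        (≃-trans (realises-≃ R) (≃-trans (blocks-≃ (hide-third f k 1<k k≤1+f))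
          (≃-sym (realises-≃
            (realises-++⁺ Ru (realises-++⁺ Rv (add (<⇒≤ 1<k) k≤n n<j R₂)))))) ▹ (1 ∷ˢ zeros))
    }
    where
    regroup : ∀ a → ((1 ∷ u) ++ (1 ∷ v) ++ a ∷ replicate j 0 ++ s) ⊕ 1 ∷ˢ zeros
                    ≡ (1 ∷ u) ⊕ (1 ∷ v) ⊕ a ∷ˢ (replicate j 0 ++ s) ⊕ 1 ∷ˢ zeros
    regroup a = trans (++-⊕ (1 ∷ u) _ _) (cong ((1 ∷ u) ⊕_) (++-⊕ (1 ∷ v) _ _))

-- Paths and labels of the two trees

module Instance {n : ℕ} {F : FinKripke} (D : KnSpec n F) where
  open KnSpec D
  open Unwinding F
  open Kripke unwind using (S; V)

  withLabels : (S → Bool) → Kripke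
  withLabels V′ = record unwind { V = V′ }

  node-≡ : ∀ {s s′ : S} → proj₁ s ≡ proj₁ s′ → s ≡ s′
  node-≡ {_ , p} {_ , p′} refl = cong (_ ,_) (T-irrelevant p p′)

  -- A node lies on a path only at its own depth, so relabelling one node can affect paths at
  -- position `ia` alone.
  depth : (π : InitPath unwind) → ∀ i → length (proj₁ (seq π i)) ≡ i
  depth π zero = cong length (start π)
  depth π (suc i) with step π i
  ... | c , e = trans (cong length e) (trans (length-++ (proj₁ (seq π i)))
                  (trans (+-comm _ 1) (cong suc (depth π i))))

  successor : ℕ → S
  successor zero = η
  successor (suc k) = ξ (suc k)

  pathᴷ : ℕ → InitPath unwind
  pathᴷ zero = πη
  pathᴷ (suc k) = πξ (suc k)

  successor-injective : ∀ {j j′} → j ≤ n → j′ ≤ n → successor j ≡ successor j′ → j ≡ j′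
  successor-injective {zero} {zero} _ _ _ = refl
  successor-injective {zero} {suc _} _ j′≤n e = contradiction e (η≢ξ _ (s≤s z≤n) j′≤n)
  successor-injective {suc _} {zero} j≤n _ e = contradiction (sym e) (η≢ξ _ (s≤s z≤n) j≤n)
  successor-injective {suc _} {suc _} j≤n j′≤n e = ξ-inj _ _ (s≤s z≤n) j≤n (s≤s z≤n) j′≤n e

  pathᴷ-successor : ∀ {j} → j ≤ n → seq (pathᴷ j) 1 ≡ successor j
  pathᴷ-successor {zero} _ = πη-η
  pathᴷ-successor {suc _} j≤n = πξ-ξ _ (s≤s z≤n) j≤n

  pathᴷ-unique : ∀ {j} → j ≤ n → (π : InitPath unwind) → seq π 1 ≡ successor j →
                 ∀ i → seq π i ≡ seq (pathᴷ j) i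
  pathᴷ-unique {zero} _ = πη-uniq
  pathᴷ-unique {suc _} j≤n = πξ-uniq _ (s≤s z≤n) j≤n

  classify : (π : InitPath unwind) → ∃ λ j → j ≤ n × seq π 1 ≡ successor j
  classify π with step π 0
  ... | c , e with succ-exhaustive (seq π 1) (c , trans e (cong (_++ c ∷ []) (start π)))
  ... | inj₁ e′ = 0 , z≤n , e′
  ... | inj₂ (suc k , _ , k≤n , e′) = suc k , k≤n , e′

  -- K_n and M_n differ only in their labels, so their paths are the same sequences and one
  -- construction serves both.
  pathSystem : (V′ : S → Bool) → PathSystem n (withLabels V′) (λ j i → V′ (seq (pathᴷ j) i))
  pathSystem V′ = record
    { index = λ π → proj₁ (classify (forget π))
    ; index≤ = λ π → proj₁ (proj₂ (classify (forget π)))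
    ; path = λ j → recall (pathᴷ j)
    ; index-path = λ {j} j≤n → let (j′ , j′≤n , e) = classify (forget (recall (pathᴷ j))) in
        successor-injective j′≤n j≤n (trans (sym e) (pathᴷ-successor j≤n))
    ; label = λ π i → let (j , j≤n , e) = classify (forget π) in
        cong V′ (pathᴷ-unique j≤n (forget π) e i)
    ; same-root = λ π π′ → node-≡ (trans (start π) (sym (start π′)))
    ; split = λ π π′ same → let (j , j≤n , e) = classify (forget π)
                                (j′ , j′≤n , e′) = classify (forget π′) in
        successor-injective j≤n j′≤n (trans (sym e) (trans same e′))
    }
    where
    forget : InitPath (withLabels V′) → InitPath unwind
    forget π = record { seq = seq π ; step = step π ; start = start π }
    recall : InitPath unwind → InitPath (withLabels V′)
    recall π = record { seq = seq π ; step = step π ; start = start π }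

  labelᴷ : ℕ → ℕ → Bool
  labelᴷ j i = V (seq (pathᴷ j) i)

  module _ (ia : ℕ) where

    Vᴹ : S → Bool
    Vᴹ = Kripke.V (Mn F D ia)

    labelᴹ : ℕ → ℕ → Bool
    labelᴹ j i = Vᴹ (seq (pathᴷ j) i)

    labelᴹ-elsewhere : ∀ j i → i ≢ ia → labelᴹ j i ≡ labelᴷ j i
    labelᴹ-elsewhere j i i≢ia with ≡-dec _≟_ (proj₁ (seq (pathᴷ j) i)) (proj₁ (seq (πξ 1) ia))
    ... | yes e = contradiction
      (trans (sym (depth (pathᴷ j) i)) (trans (cong length e) (depth (πξ 1) ia))) i≢ia
    ... | no _ = refl

    -- Either the node is the relabelled one, or j ≠ 1 and the label is inherited from K_n.
    labelᴹ-alert : ∀ j → (j ≢ 1 → labelᴷ j ia ≡ false) → labelᴹ j ia ≡ false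
    labelᴹ-alert j e with ≡-dec _≟_ (proj₁ (seq (pathᴷ j) ia)) (proj₁ (seq (πξ 1) ia))
    ... | yes _ = refl
    ... | no ne = e (λ { refl → ne refl })

  symbols : ∀ {s} → (∀ j → 1 ≤ j → j ≤ n → w j ≡ map (_≡ᵇ j) s) → joinUpTo w n ≡ map nonzero s →
            ∀ j → j ≤ n → ∀ i → labelᴷ j (suc i) ≡ ((s ⊕ zeros) i ≡ᵇ j)
  symbols {s} W J zero _ i =
    trans (trace-η (suc i)) (trans (cong (λ v → nthOr true v i) w0) (nthOr-map 0 s i))
    where
    w0 : w 0 ≡ map (_≡ᵇ 0) s
    w0 = trans w0-dual (trans (cong dual J)
           (trans (sym (map-∘ s)) (map-cong (λ a → not-involutive (a ≡ᵇ 0)) s)))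
  symbols {s} W J (suc j) j≤n i =
    trans (trace-ξ (suc j) (s≤s z≤n) j≤n (suc i))
      (trans (cong (λ v → nthOr false v i) (W (suc j) (s≤s z≤n) j≤n)) (nthOr-map (suc j) s i))

  -- K_n is described by `σ 1` whatever is hidden. In M_n no path carries p at the alert position,
  -- which may be written k once ξ_k is hidden; hence `σ k` describes M_n.
  indistinguishable : ∀ {f} → suc f ≡ n → ∀ ia → IsAlert D ia → Indistinguishable n labelᴷ (labelᴹ ia)
  indistinguishable {f} refl ia (1≤ia , _ , Lia , a , b , 1≤a , a<b , b<ia , La , Lb , only)
    with Realisation.fractal-word n f fractal refl
  ... | s , R , J , W = record
    { root≡ = λ j _ → sym (labelᴹ-elsewhere ia j 0 (<⇒≢ 1≤ia))
    ; hide = λ k 2≤k k≤n → σ 1 , σ k ,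
        record { symbol-at = λ j j≤n _ → onK j j≤n } ,
        record { symbol-at = λ j j≤n j≢k → onM k 2≤k j j≤n j≢k } ,
        hidden k 2≤k k≤n k≤n
    }
    where
    open Shape n
    open Split (split-third f R)
    σ : ℕ → Stream
    σ a = (1 ∷ u) ⊕ (1 ∷ v) ⊕ a ∷ˢ x
    alert = length (1 ∷ u) + (length (1 ∷ v) + 0)
    σ-alert : ∀ a → σ a alert ≡ a
    σ-alert a = trans (⊕-after (1 ∷ u) _ _) (⊕-after (1 ∷ v) 0 _)
    σ-elsewhere : ∀ a a′ i → i ≢ alert → σ a i ≡ σ a′ i
    σ-elsewhere a a′ i i≢ = ⊕-cong (1 ∷ u) i λ r i≡ → ⊕-cong (1 ∷ v) r λ where
      zero r≡ → contradiction (trans i≡ (cong (length (1 ∷ u) +_) r≡)) i≢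
      (suc _) _ → refl
    onK : ∀ j → j ≤ n → ∀ i → labelᴷ j (suc i) ≡ (σ 1 i ≡ᵇ j)
    onK j j≤n i = trans (symbols W J j j≤n i) (cong (λ τ → τ i ≡ᵇ j) (trans (++-⊕ s _ zeros) shape))
    -- Both are the third {p}-position of ξ_1; the `suc` passes over the root.
    ia≡ : suc alert ≡ ia
    ia≡ = third-unique {labelᴷ 1} (third-one x u-no-one v-no-one (onK 1 (s≤s z≤n)))
            (Lia , a , b , 1≤a , a<b , b<ia , La , Lb , only)
    onM : ∀ k → 2 ≤ k → ∀ j → j ≤ n → j ≢ k → ∀ i → labelᴹ ia j (suc i) ≡ (σ k i ≡ᵇ j)
    onM k 2≤k j j≤n j≢k i with i ≟ alert
    ... | no i≢ = trans (labelᴹ-elsewhere ia j (suc i) (λ e → i≢ (suc-injective (trans e (sym ia≡)))))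
                    (trans (onK j j≤n i) (cong (_≡ᵇ j) (σ-elsewhere 1 k i i≢)))
    ... | yes refl = begin
      labelᴹ ia j (suc i) ≡⟨ cong (labelᴹ ia j) ia≡ ⟩
      labelᴹ ia j ia ≡⟨ labelᴹ-alert ia j (λ j≢1 → begin
        labelᴷ j ia ≡⟨ cong (labelᴷ j) ia≡ ⟨
        labelᴷ j (suc i) ≡⟨ onK j j≤n i ⟩
        (σ 1 i ≡ᵇ j) ≡⟨ cong (_≡ᵇ j) (σ-alert 1) ⟩
        (1 ≡ᵇ j) ≡⟨ ≢⇒≡ᵇ-false 1 j (≢-sym j≢1) ⟩
        false ∎) ⟩
      false ≡⟨ ≢⇒≡ᵇ-false k j (≢-sym j≢k) ⟨
      (k ≡ᵇ j) ≡⟨ cong (_≡ᵇ j) (σ-alert k) ⟨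
      (σ k i ≡ᵇ j) ∎
      where open ≡-Reasoning

theorem4 : (n : ℕ) → 1 < n → (F : FinKripke) → (D : KnSpec n F) →
    (ia : ℕ) → IsAlert D ia →
    (ψ : Formula) → Sentence ψ → size ψ < n →
    Models (Kn F) ψ ⇔ Models (Mn F D ia) ψ
theorem4 n@(suc _) 1<n F D ia alert ψ sentence small =
  mk⇔ (models-transfer K M I ψ sentence small)
      (models-transfer M K (indistinguishable-sym I) ψ sentence small)
  where
  open Instance D
  K = pathSystem (Kripke.V (Kn F))
  M = pathSystem (Kripke.V (Mn F D ia))
  I = indistinguishable refl ia alert
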